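{- For every integer $n\ge 1$, $$\mathrm{pf}_n(132,213,312)=\mathrm{pf}_n(213,231,312)=C_{n+1}-C_n,$$ where $C_k=\frac{1}{k+1}\binom{2k}{k}$ is the $k$th Catalan number.
   Context: A Dyck path of semilength $n$ is a lattice path from $(0,0)$ to $(n,n)$ consisting of $n$ north steps $N=(0,1)$ and $n$ east steps $E=(1,0)$ that never goes below the line $y=x$. A parking function of size $n$ is a Dyck path of semilength $n$ whose $n$ north steps are labeled bijectively by $\{1,\dots,n\}$ so that whenever two north steps are consecutive in the path (one immediately following the other), the label of the later one is larger. For a parking function $p$ of size $n$, $\phi(p)$ is the permutation of $\{1,\dots,n\}$ (in one-line notation) obtained by reading the labels of the north steps in the order they occur along the path. A permutation $\pi$ of $\{1,\dots,n\}$ contains a permutation $\rho$ of $\{1,\dots,m\}$ if there are indices $1\le i_1<\cdots<i_m\le n$ such that $\pi_{i_a}\le\pi_{i_b}$ if and only if $\rho_a\le\rho_b$; otherwise $\pi$ avoids $\rho$. For permutations $\rho_1,\dots,\rho_r$, $\mathrm{pf}_n(\rho_1,\dots,\rho_r)$ denotes the number of parking functions $p$ of size $n$ such that $\phi(p)$ avoids each of $\rho_1,\dots,\rho_r$. -}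

module Defs where

open import Data.Nat using (ℕ; suc; _*_; _/_; _≤_; _<_)
open import Data.Nat.Combinatorics using (_C_)
import Data.Fin as Fin
open Fin using (Fin)
open import Data.List using (List; []; _∷_; length; lookup; map; upTo)
open import Data.List.Relation.Unary.All using (All)
open import Data.List.Relation.Unary.Linked using (Linked)
open import Data.List.Relation.Binary.Permutation.Propositional
  using (_↭_; ↭-refl; ↭-trans; ↭-prep; ↭-swap)
open import Data.Product using (∃; ∃-syntax; Σ-syntax; _×_; _,_; proj₁)
open import Data.Unit using (⊤)
open import Function using (_⇔_; Inverse)
open import Level using (0ℓ)
open import Relation.Binary using (Setoid)
import Relation.Binary.Construct.On as On
open import Relation.Binary.PropositionalEquality using (setoid)
open import Relation.Nullary using (¬_)

-- The quotient is exact, and catalan k ≤ catalan (suc k), so that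
-- catalan (suc k) ∸ catalan k is the true difference.
catalan : ℕ → ℕ
catalan k = ((2 * k) C k) / suc k

record Permutation (n : ℕ) : Set where
  constructor perm
  field
    oneLine       : List ℕ
    isPermutation : oneLine ↭ map suc (upTo n)

open Permutation public

_Contains_ : ∀ {n m} → Permutation n → Permutation m → Set
π Contains ρ =
  Σ[ i ∈ (Fin (length (oneLine ρ)) → Fin (length (oneLine π))) ]
         (∀ {a b} → a Fin.< b → i a Fin.< i b)
       × (∀ a b → (lookup (oneLine π) (i a) ≤ lookup (oneLine π) (i b))
                  ⇔ (lookup (oneLine ρ) a ≤ lookup (oneLine ρ) b))

_Avoids_ : ∀ {n m} → Permutation n → Permutation m → Set
π Avoids ρ = ¬ (π Contains ρ)

data Step : Set where
  N : ℕ → Step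
  E : Step

-- DyckFrom n x y s: the steps s lead from (x , y) to (n , n), each east step
-- ending weakly above the diagonal.
data DyckFrom (n : ℕ) : ℕ → ℕ → List Step → Set where
  end   : DyckFrom n n n []
  north : ∀ {x y l s} → DyckFrom n x (suc y) s → DyckFrom n x y (N l ∷ s)
  east  : ∀ {x y s} → suc x ≤ y → DyckFrom n (suc x) y s → DyckFrom n x y (E ∷ s)

labels : List Step → List ℕ
labels []        = []
labels (N l ∷ s) = l ∷ labels s
labels (E ∷ s)   = labels s

-- Constrains only two north steps in immediate succession.
Increasing : Step → Step → Set
Increasing (N a) (N b) = a < b
Increasing (N _) E     = ⊤
Increasing E     _     = ⊤

record ParkingFunction (n : ℕ) : Set where
  field
    steps      : List Step
    isDyck     : DyckFrom n 0 0 steps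
    bijective  : labels steps ↭ map suc (upTo n)
    increasing : Linked Increasing steps

open ParkingFunction public

φ : ∀ {n} → ParkingFunction n → Permutation n
φ p = perm (labels (steps p)) (bijective p)

-- Two parking functions are equal when their labelled paths are; the proof
-- components are disregarded.
AvoidingPF : ℕ → List (∃ Permutation) → Setoid 0ℓ 0ℓ
AvoidingPF n ρs = On.setoid (setoid (List Step)) (λ (p : Carrier) → steps (proj₁ p))
  where
  Carrier : Set
  Carrier = ∃[ p ] All (λ (_ , ρ) → φ {n} p Avoids ρ) ρs

-- pf[ n , ρs ]≡ k says that the number pf_n(ρs) is k, as a bijection with Fin k.
pf[_,_]≡_ : ℕ → List (∃ Permutation) → ℕ → Set
pf[ n , ρs ]≡ k = Inverse (AvoidingPF n ρs) (setoid (Fin k))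

π132 π213 π231 π312 : ∃ Permutation
π132 = 3 , perm (1 ∷ 3 ∷ 2 ∷ []) (↭-prep 1 (↭-swap 3 2 ↭-refl))
π213 = 3 , perm (2 ∷ 1 ∷ 3 ∷ []) (↭-swap 2 1 ↭-refl)
π231 = 3 , perm (2 ∷ 3 ∷ 1 ∷ []) (↭-trans (↭-prep 2 (↭-swap 3 1 ↭-refl)) (↭-swap 2 1 ↭-refl))
π312 = 3 , perm (3 ∷ 1 ∷ 2 ∷ []) (↭-trans (↭-swap 3 1 ↭-refl) (↭-prep 1 (↭-swap 3 2 ↭-refl)))

{-# OPTIONS --safe #-}

-- Avoiding 213 and 312 makes a permutation unimodal; avoiding in addition 132 (resp. 231) leaves,
-- for each number i < n of ascents, only k, k+1, …, n, k−1, …, 1 with k = n − i (resp.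
-- 1, …, k−1, n, n−1, …, k with k = i + 1). The two kinds of list are reverses of each other, so the
-- same asymmetric relation, read forwards or backwards from the entry k, characterises both. A
-- parking function with a label sequence of i ascents followed by m descents is a path in which
-- every descent forces an east step. From excess d = y − x over the diagonal there are, by Pascal's
-- rule, C(d+2i+m+1, d+i) − C(d+2i+m+1, i−1) such paths. At d = 0, m = n−1−i, summing over i by the
-- hockey-stick identity gives C(2n, n−1) − C(2n, n−2), which is the difference of the Catalan
-- numbers C(2n+2, n+1) − C(2n+2, n) and C(2n, n) − C(2n, n−1).
module Submission where

open import Defs
open import Algebra.Properties.CommutativeSemigroup using (interchange)
open import Data.Nat
open import Data.Nat.Combinatorics
  using (_C_; nCk+nC[k+1]≡[n+1]C[k+1]; k>n⇒nCk≡0; nC1≡n; nCn≡1; nCk≡nC[n∸k])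
open import Data.Nat.DivMod using (m*n/n≡m; /-congˡ)
open import Data.Nat.Properties
open import Data.Nat.Tactic.RingSolver using (solve-∀)
open import Data.Fin as Fin using (Fin; zero; suc)
open import Data.Fin.Patterns using (0F; 1F; 2F)
open import Data.List using
  (List; []; _∷_; _++_; map; length; lookup; replicate; upTo; applyUpTo; applyDownFrom; initLast; _∷ʳ′_)
open import Data.List.Properties
open import Data.List.Membership.Propositional using (_∈_)
open import Data.List.Membership.Propositional.Properties
open import Data.List.Relation.Binary.Permutation.Propositional
  using (_↭_; ↭-sym; ↭-trans; ↭-reflexive; ↭⇒↭ₛ; module PermutationReasoning)
open import Data.List.Relation.Binary.Permutation.Propositional.Properties
  using (∈-resp-↭; drop-∷; ↭-reverse; ++-comm; ++⁺ˡ; ++⁺ʳ; ↭-length)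
import Data.List.Relation.Binary.Permutation.Setoid.Properties as PermutationSetoid
open import Data.List.Relation.Binary.Sublist.Propositional using (_⊆_; []; _∷_; _∷ʳ_; from∈; ⊆-refl)
import Data.List.Relation.Binary.Sublist.Propositional.Properties as Sublist
open import Data.List.Relation.Unary.All as All using (All; []; _∷_)
import Data.List.Relation.Unary.All.Properties as All
open import Data.List.Relation.Unary.AllPairs as AllPairs using (AllPairs; []; _∷_)
import Data.List.Relation.Unary.AllPairs.Properties as AllPairs
open import Data.List.Relation.Unary.Any using (here; there; index)
open import Data.List.Relation.Unary.Any.Properties using (lookup-index)
open import Data.List.Relation.Unary.Linked as Linked using (Linked; []; [-]; _∷_)
open import Data.List.Relation.Unary.Linked.Properties using (AllPairs⇒Linked)
open import Data.List.Relation.Unary.Unique.Propositional using (Unique)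
import Data.List.Relation.Unary.Unique.Propositional.Properties as Unique
open import Data.Product using (_×_; _,_; proj₁; proj₂; ∃; ∃-syntax; uncurry)
open import Data.Sum using (_⊎_; inj₁; inj₂)
open import Data.Unit using (tt)
open import Function
open import Level using (0ℓ)
open import Relation.Binary using (Rel; Asymmetric; tri<; tri≈; tri>)
import Relation.Binary.Construct.On as On
open import Relation.Binary.PropositionalEquality
open import Relation.Nullary

-- Binomial coefficients and Catalan numbers

pascal : ∀ n k → suc n C suc k ≡ n C k + n C suc k
pascal n k = sym (nCk+nC[k+1]≡[n+1]C[k+1] n k)

infixl 6.5 _C₋_

-- The binomial coefficient with lower index `k - 1`, where the index -1 must give 0; truncated
-- subtraction would give `n C 0`, which is 1.
_C₋_ : ℕ → ℕ → ℕ
n C₋ zero  = 0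
n C₋ suc k = n C k

pascal₋ : ∀ n k → suc n C₋ suc k ≡ n C₋ k + n C₋ suc k
pascal₋ n zero    = refl
pascal₋ n (suc k) = pascal n k

-- This is (k+1) C(n,k+1) = (n-k) C(n,k) with the subtraction moved across. Pascal's rule on both
-- terms reduces row `suc n` to the instances at `k` and `suc k` in row `n`.
absorption : ∀ n k → suc k * (n C suc k) + k * (n C k) ≡ n * (n C k)
absorption zero    zero    = refl
absorption zero    (suc k) = trans (cong₂ (λ a b → suc (suc k) * a + suc k * b)
  (k>n⇒nCk≡0 {0} {suc (suc k)} z<s) (k>n⇒nCk≡0 {0} {suc k} z<s)) (zeros k)
  where
  zeros : ∀ k → suc (suc k) * 0 + suc k * 0 ≡ 0
  zeros = solve-∀
absorption (suc n) zero = begin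
  1 * (suc n C 1) + 0   ≡⟨ cong (λ a → 1 * a + 0) (nC1≡n (suc n)) ⟩
  1 * suc n + 0         ≡⟨ +-identityʳ (1 * suc n) ⟩
  1 * suc n             ≡⟨ *-comm 1 (suc n) ⟩
  suc n * 1             ∎
  where open ≡-Reasoning
absorption (suc n) (suc k) = begin
  suc (suc k) * (suc n C suc (suc k)) + suc k * (suc n C suc k)
    ≡⟨ cong₂ (λ x y → suc (suc k) * x + suc k * y) (pascal n (suc k)) (pascal n k) ⟩
  suc (suc k) * (b + c) + suc k * (a + b)
    ≡⟨ regroup k a b c ⟩
  (suc (suc k) * c + suc k * b) + (suc k * b + k * a) + (a + b)
    ≡⟨ cong₂ (λ x y → x + y + (a + b)) (absorption n (suc k)) (absorption n k) ⟩
  n * b + n * a + (a + b)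
    ≡⟨ collect n a b ⟩
  suc n * (a + b)
    ≡⟨ cong (suc n *_) (pascal n k) ⟨
  suc n * (suc n C suc k) ∎
  where
  open ≡-Reasoning
  a = n C k
  b = n C suc k
  c = n C suc (suc k)
  regroup : ∀ k a b c → suc (suc k) * (b + c) + suc k * (a + b)
          ≡ (suc (suc k) * c + suc k * b) + (suc k * b + k * a) + (a + b)
  regroup = solve-∀
  collect : ∀ n a b → n * b + n * a + (a + b) ≡ suc n * (a + b)
  collect = solve-∀

-- The reflection form C(2k,k) - C(2k,k-1) of the Catalan number. Absorption gives kX = (k+1)Y for
-- these two binomials, hence X = (X-Y)(k+1), and the division in `catalan` is exact with quotient X
-- - Y.
catalan-reflection : ∀ k → catalan k + (2 * k) C₋ k ≡ (2 * k) C k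
catalan-reflection zero    = refl
catalan-reflection (suc j) = begin
  catalan k + Y                   ≡⟨ cong (_+ Y) (/-congˡ {o = suc k} X≡[X∸Y][1+k]) ⟩
  ((X ∸ Y) * suc k) / suc k + Y   ≡⟨ cong (_+ Y) (m*n/n≡m (X ∸ Y) (suc k)) ⟩
  X ∸ Y + Y                       ≡⟨ m∸n+n≡m Y≤X ⟩
  X                               ∎
  where
  open ≡-Reasoning
  k = suc j
  X = (2 * k) C k
  Y = (2 * k) C j
  kX≡[1+k]Y : k * X ≡ suc k * Y
  kX≡[1+k]Y = +-cancelʳ-≡ (j * Y) (k * X) (suc k * Y) (trans (absorption (2 * k) j) (double j Y))
    where
    double : ∀ j Y → 2 * suc j * Y ≡ suc (suc j) * Y + j * Y
    double = solve-∀
  Y≤X : Y ≤ X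
  Y≤X = *-cancelˡ-≤ k (≤-trans (m≤n+m (k * Y) Y) (≤-reflexive (sym kX≡[1+k]Y)))
  X≡[X∸Y][1+k] : X ≡ (X ∸ Y) * suc k
  X≡[X∸Y][1+k] = begin
    X                         ≡⟨ m+n∸n≡m X (k * X) ⟨
    X + k * X ∸ k * X         ≡⟨ cong (suc k * X ∸_) kX≡[1+k]Y ⟩
    suc k * X ∸ suc k * Y     ≡⟨ *-distribˡ-∸ (suc k) X Y ⟨
    suc k * (X ∸ Y)           ≡⟨ *-comm (suc k) (X ∸ Y) ⟩
    (X ∸ Y) * suc k           ∎

-- Two uses of Pascal's rule bring both Catalan numbers to row 2n, with n = `suc j`: the larger is
-- (2b+2c) - (a+2b+c), the smaller is c - b, and their difference is b - a, which is `t`.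
catalan-difference : ∀ j t → t + (2 * suc j) C₋ j ≡ (2 * suc j) C j →
                     t ≡ catalan (suc (suc j)) ∸ catalan (suc j)
catalan-difference j t eq = sym (begin
  catalan (suc n) ∸ catalan n     ≡⟨ cong (_∸ catalan n) (sym t+cₙ≡cₙ₊₁) ⟩
  t + catalan n ∸ catalan n       ≡⟨ m+n∸n≡m t (catalan n) ⟩
  t                               ∎)
  where
  open ≡-Reasoning
  n = suc j
  a = (2 * n) C₋ j
  b = (2 * n) C j
  c = (2 * n) C n
  2[1+n] : 2 * suc n ≡ suc (suc (2 * n))
  2[1+n] = *-suc 2 n
  lower : (2 * suc n) C n ≡ (a + b) + (b + c)
  lower = begin
    (2 * suc n) C n                          ≡⟨ cong (_C n) 2[1+n] ⟩
    suc (suc (2 * n)) C suc j                ≡⟨ pascal (suc (2 * n)) j ⟩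
    suc (2 * n) C₋ suc j + suc (2 * n) C n   ≡⟨ cong₂ _+_ (pascal₋ (2 * n) j) (pascal (2 * n) j) ⟩
    (a + b) + (b + c)                        ∎
  upper : (2 * suc n) C suc n ≡ (b + c) + (b + c)
  upper = begin
    (2 * suc n) C suc n                      ≡⟨ cong (_C suc n) 2[1+n] ⟩
    suc (suc (2 * n)) C suc n                ≡⟨ pascal (suc (2 * n)) n ⟩
    suc (2 * n) C n + suc (2 * n) C suc n    ≡⟨ cong (suc (2 * n) C n +_) middle ⟩
    suc (2 * n) C n + suc (2 * n) C n        ≡⟨ cong₂ _+_ (pascal (2 * n) j) (pascal (2 * n) j) ⟩
    (b + c) + (b + c)                        ∎
    where
    1+2n : suc (2 * n) ≡ n + suc n
    1+2n = trans (cong (λ m → suc (n + m)) (+-identityʳ n)) (sym (+-suc n n))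
    middle : suc (2 * n) C suc n ≡ suc (2 * n) C n
    middle = begin
      suc (2 * n) C suc n                    ≡⟨ nCk≡nC[n∸k] (s≤s (m≤n*m n 2)) ⟩
      suc (2 * n) C (suc (2 * n) ∸ suc n)    ≡⟨ cong (λ k → suc (2 * n) C (k ∸ suc n)) 1+2n ⟩
      suc (2 * n) C (n + suc n ∸ suc n)      ≡⟨ cong (suc (2 * n) C_) (m+n∸n≡m n (suc n)) ⟩
      suc (2 * n) C n                        ∎
  t+cₙ≡cₙ₊₁ : t + catalan n ≡ catalan (suc n)
  t+cₙ≡cₙ₊₁ = +-cancelʳ-≡ ((a + b) + (b + c)) (t + catalan n) (catalan (suc n)) (begin
    t + catalan n + ((a + b) + (b + c))      ≡⟨ regroup t (catalan n) a b c ⟩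
    (t + a) + (catalan n + b) + (b + c)      ≡⟨ cong₂ (λ x y → x + y + (b + c)) eq (catalan-reflection n) ⟩
    (b + c) + (b + c)                        ≡⟨ upper ⟨
    (2 * suc n) C suc n                      ≡⟨ catalan-reflection (suc n) ⟨
    catalan (suc n) + (2 * suc n) C n        ≡⟨ cong (catalan (suc n) +_) lower ⟩
    catalan (suc n) + ((a + b) + (b + c))    ∎)
    where
    regroup : ∀ t k a b c → t + k + ((a + b) + (b + c)) ≡ (t + a) + (k + b) + (b + c)
    regroup = solve-∀

-- Enumeration of the paths with a prescribed label sequence

select : ∀ {P A : Set} → Dec P → A → A → A
select (yes _) x _ = x
select (no  _) _ y = y

select-elim : ∀ {P A : Set} {x y : A} (Q : A → Set) (p? : Dec P) →
              (P → Q x) → (¬ P → Q y) → Q (select p? x y)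
select-elim Q (yes p) f g = f p
select-elim Q (no ¬p) f g = g ¬p

-- paths d σ are the ways to finish a path with the labels σ from a point x , d + x not reached by
-- a north step; pathsAfterN a d σ start at x , suc d + x, just after N a.
mutual
  paths : ℕ → List ℕ → List (List Step)
  paths d       []      = replicate d E ∷ []
  paths zero    (a ∷ σ) = map (N a ∷_) (pathsAfterN a zero σ)
  paths (suc d) (a ∷ σ) = map (N a ∷_) (pathsAfterN a (suc d) σ) ++ map (E ∷_) (paths d (a ∷ σ))

  pathsAfterN : ℕ → ℕ → List ℕ → List (List Step)
  pathsAfterN a d []      = map (E ∷_) (paths d [])
  pathsAfterN a d (b ∷ σ) = select (a <? b) (paths (suc d) (b ∷ σ)) (map (E ∷_) (paths d (b ∷ σ)))

-- The endpoint is forced: the path starts at height `d + x` and rises once for each label.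
Valid : ℕ → ℕ → List ℕ → List Step → Set
Valid x d σ s = DyckFrom (length σ + (d + x)) x (d + x) s × Linked Increasing s × labels s ≡ σ

E∷-linked : ∀ {s} → Linked Increasing s → Linked Increasing (E ∷ s)
E∷-linked []        = [-]
E∷-linked [-]       = tt ∷ [-]
E∷-linked (r ∷ rs)  = tt ∷ r ∷ rs

N∷-linked : ∀ {a b σ s} → a < b → labels s ≡ b ∷ σ → Linked Increasing s → Linked Increasing (N a ∷ s)
N∷-linked {s = N b ∷ s} a<b refl rs = a<b ∷ rs
N∷-linked {s = E ∷ s}   a<b eq   rs = tt ∷ rs

E∷-valid : ∀ {x d σ s} → Valid (suc x) d σ s → Valid x (suc d) σ (E ∷ s)
E∷-valid {x} {d} {σ} {s} (dyck , inc , eq) =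
  east (s≤s (m≤n+m x d)) (subst (λ y → DyckFrom (length σ + y) (suc x) y s) (+-suc d x) dyck)
  , E∷-linked inc , eq

N∷-valid : ∀ {x d a σ s} → Linked Increasing (N a ∷ s) → Valid x (suc d) σ s → Valid x d (a ∷ σ) (N a ∷ s)
N∷-valid {x} {d} {a} {σ} {s} inc (dyck , _ , eq) =
  north (subst (λ n → DyckFrom n x (suc d + x) s) (+-suc (length σ) (d + x)) dyck)
  , inc , cong (a ∷_) eq

N∷E∷-valid : ∀ {x d a σ s} → Valid (suc x) d σ s → Linked Increasing (N a ∷ E ∷ s) × Valid x (suc d) σ (E ∷ s)
N∷E∷-valid v@(_ , inc , _) = tt ∷ E∷-linked inc , E∷-valid v

replicate-valid : ∀ d x → Valid x d [] (replicate d E)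
replicate-valid zero    x = end , [] , refl
replicate-valid (suc d) x = E∷-valid (replicate-valid d (suc x))

mutual
  paths-sound : ∀ d σ x → All (Valid x d σ) (paths d σ)
  paths-sound d       []      x = replicate-valid d x ∷ []
  paths-sound zero    (a ∷ σ) x =
    All.map⁺ (All.map (uncurry N∷-valid) (pathsAfterN-sound a zero σ x))
  paths-sound (suc d) (a ∷ σ) x = All.++⁺
    (All.map⁺ (All.map (uncurry N∷-valid) (pathsAfterN-sound a (suc d) σ x)))
    (All.map⁺ (All.map E∷-valid (paths-sound d (a ∷ σ) (suc x))))

  -- The junction of `N a` with `s` is settled here, where `a` is compared with the next label;
  -- `paths-sound` can then put `N a` in front of every listed path.
  pathsAfterN-sound : ∀ a d σ x →
    All (λ s → Linked Increasing (N a ∷ s) × Valid x (suc d) σ s) (pathsAfterN a d σ)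
  pathsAfterN-sound a d []      x = All.map⁺ (All.map N∷E∷-valid (paths-sound d [] (suc x)))
  pathsAfterN-sound a d (b ∷ σ) x = select-elim
    (All (λ s → Linked Increasing (N a ∷ s) × Valid x (suc d) (b ∷ σ) s)) (a <? b)
    (λ a<b → All.map (λ v@(_ , inc , eq) → N∷-linked a<b eq inc , v) (paths-sound (suc d) (b ∷ σ) x))
    (λ _   → All.map⁺ (All.map N∷E∷-valid (paths-sound d (b ∷ σ) (suc x))))

E∷-∈-paths : ∀ d σ {s} → s ∈ paths d σ → E ∷ s ∈ paths (suc d) σ
E∷-∈-paths d []      (here refl) = here refl
E∷-∈-paths d (a ∷ σ) s∈ = ∈-++⁺ʳ (map (N a ∷_) (pathsAfterN a (suc d) σ)) (∈-map⁺ (E ∷_) s∈)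

E∷-∈-pathsAfterN : ∀ a d σ {s} → s ∈ paths d σ → E ∷ s ∈ pathsAfterN a d σ
E∷-∈-pathsAfterN a d []      s∈ = ∈-map⁺ (E ∷_) s∈
E∷-∈-pathsAfterN a d (b ∷ σ) {s} s∈ = select-elim (E ∷ s ∈_) (a <? b)
  (λ _ → E∷-∈-paths d (b ∷ σ) s∈) (λ _ → ∈-map⁺ (E ∷_) s∈)

N∷-∈-paths : ∀ a d σ {s} → s ∈ pathsAfterN a d σ → N a ∷ s ∈ paths d (a ∷ σ)
N∷-∈-paths a zero    σ s∈ = ∈-map⁺ (N a ∷_) s∈
N∷-∈-paths a (suc d) σ s∈ = ∈-++⁺ˡ (∈-map⁺ (N a ∷_) s∈)

mutual
  -- The height is a variable `y` tied to `d + x` by an equation, so that matching on the Dyck path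
  -- does not have to unify against a sum.
  paths-complete : ∀ {n x y} d {s} → y ≡ d + x → DyckFrom n x y s → Linked Increasing s →
                   s ∈ paths d (labels s)
  paths-complete zero            eq   end         _   = here refl
  paths-complete {x = x} (suc d) eq   end         _   = contradiction eq (m≢1+n+m x)
  paths-complete d {N a ∷ s}     eq   (north p)   inc =
    N∷-∈-paths a d (labels s) (pathsAfterN-complete d (cong suc eq) p inc)
  paths-complete zero            refl (east x<x p) _  = contradiction x<x (n≮n _)
  paths-complete {x = x} (suc d) {E ∷ s} eq (east _ p) inc =
    E∷-∈-paths d (labels s) (paths-complete d (trans eq (sym (+-suc d x))) p (Linked.tail inc))

  pathsAfterN-complete : ∀ {n x y a} d {s} → y ≡ suc d + x → DyckFrom n x y s →
                         Linked Increasing (N a ∷ s) → s ∈ pathsAfterN a d (labels s)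
  pathsAfterN-complete {x = x} d eq end _ = contradiction eq (m≢1+n+m x)
  pathsAfterN-complete {a = a} d {N b ∷ s} eq p (a<b ∷ inc) = select-elim (N b ∷ s ∈_) (a <? b)
    (λ _ → paths-complete (suc d) eq p inc) (λ a≮b → contradiction a<b a≮b)
  pathsAfterN-complete {x = x} {a = a} d {E ∷ s} eq (east _ p) (_ ∷ inc) =
    E∷-∈-pathsAfterN a d (labels s) (paths-complete d (trans eq (sym (+-suc d x))) p (Linked.tail inc))

mutual
  paths-unique : ∀ d σ → Unique (paths d σ)
  paths-unique d       []      = [] ∷ []
  paths-unique zero    (a ∷ σ) = Unique.map⁺ ∷-injectiveʳ (pathsAfterN-unique a zero σ)
  paths-unique (suc d) (a ∷ σ) = Unique.++⁺
    (Unique.map⁺ ∷-injectiveʳ (pathsAfterN-unique a (suc d) σ))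
    (Unique.map⁺ ∷-injectiveʳ (paths-unique d (a ∷ σ)))
    N-or-E
    where
    N-or-E : ∀ {s} → ¬ (s ∈ map (N a ∷_) (pathsAfterN a (suc d) σ) × s ∈ map (E ∷_) (paths d (a ∷ σ)))
    N-or-E (∈N , ∈E) with ∈-map⁻ (N a ∷_) ∈N | ∈-map⁻ (E ∷_) ∈E
    ... | _ , _ , refl | _ , _ , ()

  pathsAfterN-unique : ∀ a d σ → Unique (pathsAfterN a d σ)
  pathsAfterN-unique a d []      = Unique.map⁺ ∷-injectiveʳ (paths-unique d [])
  pathsAfterN-unique a d (b ∷ σ) = select-elim Unique (a <? b)
    (λ _ → paths-unique (suc d) (b ∷ σ)) (λ _ → Unique.map⁺ ∷-injectiveʳ (paths-unique d (b ∷ σ)))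

-- Number of paths over a unimodal label sequence

length-pathsAfterN-< : ∀ {a b} d σ → a < b →
                       length (pathsAfterN a d (b ∷ σ)) ≡ length (paths (suc d) (b ∷ σ))
length-pathsAfterN-< {a} {b} d σ a<b with a <? b
... | yes _  = refl
... | no a≮b = contradiction a<b a≮b

-- The east step forced by the descent cancels the height gained by `N a`, so the excess is `d`
-- again. If `σ` is empty, both sides are 1.
length-pathsAfterN-> : ∀ {a} d {σ} → Linked _>_ (a ∷ σ) →
                       length (pathsAfterN a d σ) ≡ length (paths d σ)
length-pathsAfterN-> d [-] = refl
length-pathsAfterN-> {a} d {b ∷ σ} (a>b ∷ _) with a <? b
... | yes a<b = contradiction a<b (<⇒≯ a>b)
... | no  _   = length-map (E ∷_) (paths d (b ∷ σ))

length-paths-suc : ∀ d a σ → length (paths (suc d) (a ∷ σ)) ≡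
                   length (pathsAfterN a (suc d) σ) + length (paths d (a ∷ σ))
length-paths-suc d a σ = trans (length-++ (map (N a ∷_) (pathsAfterN a (suc d) σ)))
  (cong₂ _+_ (length-map (N a ∷_) (pathsAfterN a (suc d) σ)) (length-map (E ∷_) (paths d (a ∷ σ))))

-- Each north step is followed at once by an east step, so a path is a word in `length σ` blocks NE,
-- which keep the excess, and `d` further letters E, which lower it to 0. All such words are
-- allowed.
length-paths-decreasing : ∀ d {σ} → Linked _>_ σ → length (paths d σ) ≡ (d + length σ) C d
length-paths-decreasing d [] = sym (trans (cong (_C d) (+-identityʳ d)) (nCn≡1 d))
length-paths-decreasing zero {a ∷ σ} dec = begin
  length (paths 0 (a ∷ σ))     ≡⟨ length-map (N a ∷_) (pathsAfterN a 0 σ) ⟩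
  length (pathsAfterN a 0 σ)   ≡⟨ length-pathsAfterN-> 0 dec ⟩
  length (paths 0 σ)           ≡⟨ length-paths-decreasing 0 (Linked.tail dec) ⟩
  1 ∎
  where open ≡-Reasoning
length-paths-decreasing (suc d) {a ∷ σ} dec = begin
  length (paths (suc d) (a ∷ σ))
    ≡⟨ length-paths-suc d a σ ⟩
  length (pathsAfterN a (suc d) σ) + length (paths d (a ∷ σ))
    ≡⟨ cong₂ _+_ (trans (length-pathsAfterN-> (suc d) dec) (length-paths-decreasing (suc d) (Linked.tail dec)))
                 (length-paths-decreasing d dec) ⟩
  (suc d + length σ) C suc d + (d + suc (length σ)) C d
    ≡⟨ cong (λ m → (suc d + length σ) C suc d + m C d) (+-suc d (length σ)) ⟩
  (suc d + length σ) C suc d + (suc d + length σ) C d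
    ≡⟨ +-comm ((suc d + length σ) C suc d) _ ⟩
  (suc d + length σ) C d + (suc d + length σ) C suc d
    ≡⟨ pascal (suc d + length σ) d ⟨
  suc (suc d + length σ) C suc d
    ≡⟨ cong (_C suc d) (cong suc (+-suc d (length σ))) ⟨
  (suc d + suc (length σ)) C suc d ∎
  where open ≡-Reasoning

-- The indices count the ascents and the descents; the list has one entry more than their sum.
data Unimodal : ℕ → ℕ → List ℕ → Set where
  down : ∀ {a σ} → Linked _>_ (a ∷ σ) → Unimodal 0 (length σ) (a ∷ σ)
  up   : ∀ {i m a b σ} → a < b → Unimodal i m (b ∷ σ) → Unimodal (suc i) m (a ∷ b ∷ σ)

ascents-unique : ∀ {i i' m m' σ} → Unimodal i m σ → Unimodal i' m' σ → i ≡ i'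
ascents-unique (down _)         (down _)          = refl
ascents-unique (down (a>b ∷ _)) (up a<b _)        = contradiction a<b (<⇒≯ a>b)
ascents-unique (up a<b _)       (down (a>b ∷ _))  = contradiction a<b (<⇒≯ a>b)
ascents-unique (up _ u)         (up _ v)          = cong suc (ascents-unique u v)

-- Induction on the first step. A north step raises `d` by one and uses up an ascent, an east step
-- lowers `d` by one; either way `S` drops by exactly one. Both subcounts thus lie in the same row,
-- and Pascal's rule adds up the two binomials separately.
length-paths-unimodal : ∀ {i m σ} S d → Unimodal i m σ → S ≡ d + (i + i) + m →
                        length (paths d σ) + suc S C₋ i ≡ suc S C (d + i)
length-paths-unimodal S d (down {a} {σ} dec) eq = begin
  length (paths d (a ∷ σ)) + 0     ≡⟨ +-identityʳ _ ⟩
  length (paths d (a ∷ σ))         ≡⟨ length-paths-decreasing d dec ⟩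
  (d + suc (length σ)) C d         ≡⟨ cong₂ _C_ 1+S (+-identityʳ d) ⟨
  suc S C (d + 0)                  ∎
  where
  open ≡-Reasoning
  shift : ∀ d l → suc (d + 0 + l) ≡ d + suc l
  shift = solve-∀
  1+S : suc S ≡ d + suc (length σ)
  1+S = trans (cong suc eq) (shift d (length σ))
-- On the diagonal no east step is possible. The formula agrees: at excess -1 it would read
-- `suc S C i` minus itself, and this is the term carried along on both sides.
length-paths-unimodal {suc i} {m} (suc S) zero (up {a = a} {b} {σ} a<b u) eq = begin
  length (paths 0 (a ∷ b ∷ σ)) + suc (suc S) C₋ suc i
    ≡⟨ cong₂ _+_ (trans (length-map (N a ∷_) (pathsAfterN a 0 (b ∷ σ))) (length-pathsAfterN-< 0 σ a<b))
                 (pascal₋ (suc S) i) ⟩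
  L + (suc S C₋ i + suc S C i)
    ≡⟨ +-assoc L (suc S C₋ i) (suc S C i) ⟨
  L + suc S C₋ i + suc S C i
    ≡⟨ cong (_+ suc S C i) (length-paths-unimodal S 1 u (trans (suc-injective eq) (cong (_+ m) (+-suc i i)))) ⟩
  suc S C suc i + suc S C i
    ≡⟨ +-comm (suc S C suc i) (suc S C i) ⟩
  suc S C i + suc S C suc i
    ≡⟨ pascal (suc S) i ⟨
  suc (suc S) C suc i ∎
  where
  open ≡-Reasoning
  L = length (paths 1 (b ∷ σ))
length-paths-unimodal {suc i} {m} (suc S) (suc d) (up {a = a} {b} {σ} a<b u) eq = begin
  length (paths (suc d) (a ∷ b ∷ σ)) + suc (suc S) C₋ suc i
    ≡⟨ cong₂ _+_ (trans (length-paths-suc d a (b ∷ σ)) (cong (_+ L') (length-pathsAfterN-< (suc d) σ a<b)))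
                 (pascal₋ (suc S) i) ⟩
  (L + L') + (suc S C₋ i + suc S C₋ suc i)
    ≡⟨ interchange +-commutativeSemigroup L L' (suc S C₋ i) (suc S C₋ suc i) ⟩
  (L + suc S C₋ i) + (L' + suc S C₋ suc i)
    ≡⟨ cong₂ _+_ (length-paths-unimodal S (suc (suc d)) u (trans (suc-injective eq) (shift d i m)))
                 (length-paths-unimodal S d (up a<b u) (suc-injective eq)) ⟩
  suc S C suc (suc d + i) + suc S C (d + suc i)
    ≡⟨ cong (λ k → suc S C suc (suc d + i) + suc S C k) (+-suc d i) ⟩
  suc S C suc (suc d + i) + suc S C (suc d + i)
    ≡⟨ +-comm (suc S C suc (suc d + i)) (suc S C (suc d + i)) ⟩
  suc S C (suc d + i) + suc S C suc (suc d + i)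
    ≡⟨ pascal (suc S) (suc d + i) ⟨
  suc (suc S) C suc (suc d + i)
    ≡⟨ cong (suc (suc S) C_) (+-suc (suc d) i) ⟨
  suc (suc S) C (suc d + suc i) ∎
  where
  open ≡-Reasoning
  L  = length (paths (suc (suc d)) (b ∷ σ))
  L' = length (paths d (a ∷ b ∷ σ))
  shift : ∀ d i m → d + (suc i + suc i) + m ≡ suc (suc d) + (i + i) + m
  shift = solve-∀

-- Counting a class that has one label sequence for each number of ascents

lookup-injective : ∀ {A : Set} {xs : List A} → Unique xs → ∀ {i j} → lookup xs i ≡ lookup xs j → i ≡ j
lookup-injective (_ ∷ _)   {zero}  {zero}  _  = refl
lookup-injective (x∉ ∷ _)  {zero}  {suc j} eq = contradiction eq (All.lookup x∉ (∈-lookup j))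
lookup-injective (x∉ ∷ _)  {suc i} {zero}  eq = contradiction (sym eq) (All.lookup x∉ (∈-lookup i))
lookup-injective (_ ∷ xs!) {suc i} {suc j} eq = cong suc (lookup-injective xs! eq)

-- Elements of `C` are identified when `f` agrees on them, so the position of `f c` in `xs` is the
-- bijection. Absence of repetitions makes it independent of the membership proof chosen.
enumerated⇒Fin : ∀ {A C : Set} (f : C → A) {xs : List A} → Unique xs →
                 (∀ c → f c ∈ xs) → (∀ {x} → x ∈ xs → ∃[ c ] f c ≡ x) →
                 Inverse (On.setoid (setoid A) f) (setoid (Fin (length xs)))
enumerated⇒Fin f {xs} xs! f∈ preimage = record
  { to        = λ c → index (f∈ c)
  ; from      = λ i → proj₁ (preimage (∈-lookup i))
  ; to-cong   = λ {c} {c'} eq → lookup-injective xs!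
      (trans (sym (lookup-index (f∈ c))) (trans eq (lookup-index (f∈ c'))))
  ; from-cong = λ { refl → refl }
  ; inverse   =
      (λ {i} {c} eq → lookup-injective xs!
        (trans (sym (lookup-index (f∈ c))) (trans eq (proj₂ (preimage (∈-lookup i))))))
    , (λ { {c} refl → trans (proj₂ (preimage (∈-lookup (index (f∈ c))))) (sym (lookup-index (f∈ c))) })
  }

-- The patterns enter only through these parameters: the avoiders of size `suc n` are the lists
-- `family i (n ∸ i)` with `i ≤ n`.
module Counting
  (ρs : List (∃ Permutation))
  (family : ℕ → ℕ → List ℕ)
  (unimodal : ∀ i m → Unimodal i m (family i m))
  (family-↭ : ∀ i m → family i m ↭ map suc (upTo (suc (i + m))))
  (family-avoids : ∀ {n} (π : Permutation n) i m → oneLine π ≡ family i m →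
                   All (λ (_ , ρ) → π Avoids ρ) ρs)
  (avoids-family : ∀ {n} (π : Permutation (suc n)) → All (λ (_ , ρ) → π Avoids ρ) ρs →
                   ∃[ i ] i ≤ n × oneLine π ≡ family i (n ∸ i))
  where

  -- For semilength `suc n`, the paths whose labels have fewer than `k` ascents; `k = suc n` gives
  -- all of them.
  enumeration : ℕ → ℕ → List (List Step)
  enumeration n zero    = []
  enumeration n (suc k) = enumeration n k ++ paths 0 (family k (n ∸ k))

  ∈-enumeration⁺ : ∀ n {i k s} → i < k → s ∈ paths 0 (family i (n ∸ i)) → s ∈ enumeration n k
  ∈-enumeration⁺ n {i} {suc k} i<1+k s∈ with m<1+n⇒m<n∨m≡n i<1+k
  ... | inj₁ i<k  = ∈-++⁺ˡ (∈-enumeration⁺ n i<k s∈)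
  ... | inj₂ refl = ∈-++⁺ʳ (enumeration n k) s∈

  ∈-enumeration⁻ : ∀ n k {s} → s ∈ enumeration n k → ∃[ i ] i < k × s ∈ paths 0 (family i (n ∸ i))
  ∈-enumeration⁻ n (suc k) s∈ with ∈-++⁻ (enumeration n k) s∈
  ... | inj₂ s∈paths = k , ≤-refl , s∈paths
  ... | inj₁ s∈enum  with i , i<k , s∈paths ← ∈-enumeration⁻ n k s∈enum = i , m≤n⇒m≤1+n i<k , s∈paths

  labels-paths : ∀ σ {s} → s ∈ paths 0 σ → labels s ≡ σ
  labels-paths σ s∈ = proj₂ (proj₂ (All.lookup (paths-sound 0 σ 0) s∈))

  enumeration-unique : ∀ n k → Unique (enumeration n k)
  enumeration-unique n zero    = []
  enumeration-unique n (suc k) =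
    Unique.++⁺ (enumeration-unique n k) (paths-unique 0 (family k (n ∸ k))) disjoint
    where
    -- A common path would have both families' lists as its labels, and so two different numbers of
    -- ascents.
    disjoint : ∀ {s} → ¬ (s ∈ enumeration n k × s ∈ paths 0 (family k (n ∸ k)))
    disjoint (s∈enum , s∈paths) with i , i<k , s∈paths' ← ∈-enumeration⁻ n k s∈enum =
      <⇒≢ i<k (ascents-unique (unimodal i (n ∸ i)) (subst (Unimodal k (n ∸ k))
        (trans (sym (labels-paths _ s∈paths)) (labels-paths _ s∈paths')) (unimodal k (n ∸ k))))

  length-family : ∀ {n k} → k ≤ n →
                  length (paths 0 (family k (n ∸ k))) + (suc n + k) C₋ k ≡ (suc n + k) C k
  length-family {n} {k} k≤n = length-paths-unimodal (n + k) 0 (unimodal k (n ∸ k)) (begin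
    n + k               ≡⟨ +-comm n k ⟩
    k + n               ≡⟨ cong (k +_) (m+[n∸m]≡n k≤n) ⟨
    k + (k + (n ∸ k))   ≡⟨ +-assoc k k (n ∸ k) ⟨
    k + k + (n ∸ k)     ∎)
    where open ≡-Reasoning

  -- The hockey-stick identity for both binomials at once: partial sums along a diagonal of Pascal's
  -- triangle are single entries of the next row.
  length-enumeration : ∀ {n} k → k ≤ n →
                       length (enumeration n (suc k)) + (suc n + suc k) C₋ k ≡ (suc n + suc k) C k
  -- The upper index is one too small here, but at lower indices -1 and 0 every row has the entries
  -- 0 and 1.
  length-enumeration     zero    k≤n = length-family k≤n
  length-enumeration {n} (suc k) k<n = begin
    length (enumeration n (suc k) ++ P) + (suc n + suc (suc k)) C₋ suc k
      ≡⟨ cong₂ _+_ (length-++ (enumeration n (suc k))) (cong (_C₋ suc k) (+-suc (suc n) (suc k))) ⟩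
    A + B + suc M C₋ suc k
      ≡⟨ cong (A + B +_) (pascal₋ M k) ⟩
    A + B + (M C₋ k + M C₋ suc k)
      ≡⟨ interchange +-commutativeSemigroup A B (M C₋ k) (M C₋ suc k) ⟩
    (A + M C₋ k) + (B + M C₋ suc k)
      ≡⟨ cong₂ _+_ (length-enumeration k (<⇒≤ k<n)) (length-family k<n) ⟩
    M C k + M C suc k
      ≡⟨ pascal M k ⟨
    suc M C suc k
      ≡⟨ cong (_C suc k) (+-suc (suc n) (suc k)) ⟨
    (suc n + suc (suc k)) C suc k ∎
    where
    open ≡-Reasoning
    P = paths 0 (family (suc k) (n ∸ suc k))
    A = length (enumeration n (suc k))
    B = length P
    M = suc n + suc k

  length-enumeration-catalan : ∀ n → length (enumeration n (suc n)) ≡ catalan (suc (suc n)) ∸ catalan (suc n)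
  length-enumeration-catalan n = catalan-difference n (length (enumeration n (suc n)))
    (subst (λ M → length (enumeration n (suc n)) + M C₋ n ≡ M C n) (cong (suc n +_) (sym (+-identityʳ (suc n))))
      (length-enumeration n ≤-refl))

  parkingFunction : ∀ {n i s} → i ≤ n → s ∈ paths 0 (family i (n ∸ i)) → ∃[ p ] steps {suc n} p ≡ s
  parkingFunction {n} {i} {s} i≤n s∈ = record
    { steps      = s
    ; isDyck     = subst (λ k → DyckFrom k 0 0 s) size dyck
    ; bijective  = subst (_↭ map suc (upTo (suc n))) (sym eq) perm↭
    ; increasing = inc
    } , refl
    where
    σ = family i (n ∸ i)
    valid = All.lookup (paths-sound 0 σ 0) s∈
    dyck = proj₁ valid
    inc = proj₁ (proj₂ valid)
    eq = proj₂ (proj₂ valid)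
    perm↭ : σ ↭ map suc (upTo (suc n))
    perm↭ = subst (λ k → σ ↭ map suc (upTo (suc k))) (m+[n∸m]≡n i≤n) (family-↭ i (n ∸ i))
    size : length σ + 0 ≡ suc n
    size = begin
      length σ + 0                      ≡⟨ +-identityʳ _ ⟩
      length σ                          ≡⟨ ↭-length perm↭ ⟩
      length (map suc (upTo (suc n)))   ≡⟨ length-map suc (upTo (suc n)) ⟩
      length (upTo (suc n))             ≡⟨ length-upTo (suc n) ⟩
      suc n                             ∎
      where open ≡-Reasoning

  count : ∀ n → pf[ suc n , ρs ]≡ (catalan (suc (suc n)) ∸ catalan (suc n))
  count n = subst (λ k → Inverse (AvoidingPF (suc n) ρs) (setoid (Fin k))) (length-enumeration-catalan n)
    (enumerated⇒Fin (λ (p , _) → steps p) (enumeration-unique n (suc n)) listed realised)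
    where
    listed : (c : ∃[ p ] All (λ (_ , ρ) → φ {suc n} p Avoids ρ) ρs) → steps (proj₁ c) ∈ enumeration n (suc n)
    listed (p , avoids) with i , i≤n , eq ← avoids-family (φ p) avoids =
      ∈-enumeration⁺ n (s≤s i≤n) (subst (λ σ → steps p ∈ paths 0 σ) eq
        (paths-complete 0 refl (isDyck p) (increasing p)))
    realised : ∀ {s} → s ∈ enumeration n (suc n) →
               ∃[ c ] steps (proj₁ {B = λ p → All (λ (_ , ρ) → φ {suc n} p Avoids ρ) ρs} c) ≡ s
    realised s∈ with i , s≤s i≤n , s∈paths ← ∈-enumeration⁻ n (suc n) s∈
                with p , refl ← parkingFunction i≤n s∈paths =
      (p , family-avoids (φ p) i (n ∸ i) (labels-paths _ s∈paths)) , refl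

-- Pairwise relations on lists and pattern containment

AllPairs-lookup : ∀ {A : Set} {R : Rel A 0ℓ} {xs} → AllPairs R xs →
                  ∀ {i j} → i Fin.< j → R (lookup xs i) (lookup xs j)
AllPairs-lookup (Rx ∷ _)  {zero}  {suc j} _         = All.lookup Rx (∈-lookup j)
AllPairs-lookup (_ ∷ Rxs) {suc i} {suc j} (s≤s i<j) = AllPairs-lookup Rxs i<j

-- Pairs are given as sublists so that adjoining a fixed first or last entry turns them into
-- candidate occurrences of a pattern.
⊆⇒AllPairs : ∀ {A : Set} {R : Rel A 0ℓ} xs → (∀ {x y} → x ∷ y ∷ [] ⊆ xs → R x y) → AllPairs R xs
⊆⇒AllPairs []       f = []
⊆⇒AllPairs (x ∷ xs) f = All.tabulate (λ y∈ → f (refl ∷ from∈ y∈)) ∷ ⊆⇒AllPairs xs (λ τ → f (x ∷ʳ τ))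

-- If the heads differed, each would occur later in the other list, and they would be related both
-- ways. Avoiders are thereby identified with explicit lists without being rebuilt entry by entry.
↭-AllPairs-unique : ∀ {A : Set} {R : Rel A 0ℓ} → Asymmetric R → ∀ {xs ys} →
                    AllPairs R xs → AllPairs R ys → xs ↭ ys → xs ≡ ys
↭-AllPairs-unique asym {[]}     {[]}     _ _ _ = refl
↭-AllPairs-unique asym {[]}     {y ∷ ys} _ _ p with () ← ↭-length p
↭-AllPairs-unique asym {x ∷ xs} {[]}     _ _ p with () ← ↭-length p
↭-AllPairs-unique asym {x ∷ xs} {y ∷ ys} (Rx ∷ Rxs) (Ry ∷ Rys) p
  with ∈-resp-↭ p (here refl) | ∈-resp-↭ (↭-sym p) (here refl)
... | here refl | _         = cong (x ∷_) (↭-AllPairs-unique asym Rxs Rys (drop-∷ p))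
... | there _   | here refl = cong (x ∷_) (↭-AllPairs-unique asym Rxs Rys (drop-∷ p))
... | there x∈  | there y∈  = contradiction (All.lookup Ry x∈) (asym (All.lookup Rx y∈))

AllPairs-resp-⊆ : ∀ {A : Set} {R : Rel A 0ℓ} {xs ys} → xs ⊆ ys → AllPairs R ys → AllPairs R xs
AllPairs-resp-⊆ []         []         = []
AllPairs-resp-⊆ (_ ∷ʳ τ)   (_ ∷ Rys)  = AllPairs-resp-⊆ τ Rys
AllPairs-resp-⊆ (refl ∷ τ) (Ry ∷ Rys) = Sublist.All-resp-⊆ τ Ry ∷ AllPairs-resp-⊆ τ Rys

⊆-index : ∀ {A : Set} {xs ys : List A} → xs ⊆ ys → Fin (length xs) → Fin (length ys)
⊆-index (y ∷ʳ τ)   i       = suc (⊆-index τ i)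
⊆-index (refl ∷ τ) zero    = zero
⊆-index (refl ∷ τ) (suc i) = suc (⊆-index τ i)

⊆-index-mono : ∀ {A : Set} {xs ys : List A} (τ : xs ⊆ ys) {i j} → i Fin.< j → ⊆-index τ i Fin.< ⊆-index τ j
⊆-index-mono (y ∷ʳ τ)   i<j                       = s≤s (⊆-index-mono τ i<j)
⊆-index-mono (refl ∷ τ) {zero}  {suc j} _         = z<s
⊆-index-mono (refl ∷ τ) {suc i} {suc j} (s≤s i<j) = s≤s (⊆-index-mono τ i<j)

lookup-⊆-index : ∀ {A : Set} {xs ys : List A} (τ : xs ⊆ ys) i → lookup ys (⊆-index τ i) ≡ lookup xs i
lookup-⊆-index (y ∷ʳ τ)   i       = lookup-⊆-index τ i
lookup-⊆-index (refl ∷ τ) zero    = refl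
lookup-⊆-index (refl ∷ τ) (suc i) = lookup-⊆-index τ i

-- Strict in both pairs, so that one proof yields the equivalence required by `_Contains_` and, by
-- symmetry, the reversed one.
SameOrder : ℕ → ℕ → ℕ → ℕ → Set
SameOrder x y p q = (x < y × p < q) ⊎ (y < x × q < p)

sameOrder⇒⇔ : ∀ {x y p q} → SameOrder x y p q → x ≤ y ⇔ p ≤ q
sameOrder⇒⇔ (inj₁ (x<y , p<q)) = mk⇔ (λ _ → <⇒≤ p<q) (λ _ → <⇒≤ x<y)
sameOrder⇒⇔ (inj₂ (y<x , q<p)) =
  mk⇔ (λ x≤y → contradiction x≤y (<⇒≱ y<x)) (λ p≤q → contradiction p≤q (<⇒≱ q<p))

sameOrder-sym : ∀ {x y p q} → SameOrder x y p q → SameOrder y x q p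
sameOrder-sym (inj₁ lt) = inj₂ lt
sameOrder-sym (inj₂ gt) = inj₁ gt

⊆⇒contains : ∀ {n m x y z p q r} (π : Permutation n) (ρ : Permutation m) →
             oneLine ρ ≡ p ∷ q ∷ r ∷ [] → x ∷ y ∷ z ∷ [] ⊆ oneLine π →
             SameOrder x y p q → SameOrder x z p r → SameOrder y z q r → π Contains ρ
⊆⇒contains {x = x} {y} {z} {p} {q} {r} π (perm _ _) refl τ xy xz yz =
  ⊆-index τ , ⊆-index-mono τ , λ a b →
    subst₂ (λ u v → u ≤ v ⇔ lookup (p ∷ q ∷ r ∷ []) a ≤ lookup (p ∷ q ∷ r ∷ []) b)
      (sym (lookup-⊆-index τ a)) (sym (lookup-⊆-index τ b)) (iso a b)
  where
  same : ∀ {x p} → x ≤ x ⇔ p ≤ p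
  same = mk⇔ (λ _ → ≤-refl) (λ _ → ≤-refl)
  iso : ∀ a b → lookup (x ∷ y ∷ z ∷ []) a ≤ lookup (x ∷ y ∷ z ∷ []) b ⇔
                lookup (p ∷ q ∷ r ∷ []) a ≤ lookup (p ∷ q ∷ r ∷ []) b
  iso zero             zero             = same
  iso zero             (suc zero)       = sameOrder⇒⇔ xy
  iso zero             (suc (suc zero)) = sameOrder⇒⇔ xz
  iso (suc zero)       zero             = sameOrder⇒⇔ (sameOrder-sym xy)
  iso (suc zero)       (suc zero)       = same
  iso (suc zero)       (suc (suc zero)) = sameOrder⇒⇔ yz
  iso (suc (suc zero)) zero             = sameOrder⇒⇔ (sameOrder-sym xz)
  iso (suc (suc zero)) (suc zero)       = sameOrder⇒⇔ (sameOrder-sym yz)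
  iso (suc (suc zero)) (suc (suc zero)) = same

-- For refuting an occurrence: `related` is what the positions say about its entries, `ordered` is
-- what the pattern says about their sizes.
module Occurrence {n m} (π : Permutation n) (ρ : Permutation m) {R : Rel ℕ 0ℓ}
                  (Rπ : AllPairs R (oneLine π)) (occurrence : π Contains ρ) where

  entry : Fin (length (oneLine ρ)) → ℕ
  entry a = lookup (oneLine π) (proj₁ occurrence a)

  related : ∀ a b → a Fin.< b → R (entry a) (entry b)
  related a b a<b = AllPairs-lookup Rπ (proj₁ (proj₂ occurrence) a<b)

  ordered : ∀ a b → lookup (oneLine ρ) a < lookup (oneLine ρ) b → entry a < entry b
  ordered a b ρa<ρb =
    ≰⇒> λ πb≤πa → <⇒≱ ρa<ρb (Equivalence.to (proj₂ (proj₂ occurrence) b a) πb≤πa)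

-- The order relation behind both classes

-- The order of the entries in k, k+1, …, n, k−1, …, 1.
Before : ℕ → ℕ → ℕ → Set
Before k y z = (k ≤ y × y < z) ⊎ (z < k × z < y)

Before-asym : ∀ k → Asymmetric (Before k)
Before-asym k (inj₁ (_ , y<z))   (inj₁ (_ , z<y))   = <-asym y<z z<y
Before-asym k (inj₁ (k≤y , _))   (inj₂ (y<k , _))   = <⇒≱ y<k k≤y
Before-asym k (inj₂ (z<k , _))   (inj₁ (k≤z , _))   = <⇒≱ z<k k≤z
Before-asym k (inj₂ (_ , z<y))   (inj₂ (_ , y<z))   = <-asym y<z z<y

Before-ascent : ∀ {k y z} → Before k y z → y < z → k ≤ y
Before-ascent (inj₁ (k≤y , _)) _   = k≤y
Before-ascent (inj₂ (_ , z<y)) y<z = contradiction y<z (<⇒≯ z<y)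

Before-descent : ∀ {k y z} → Before k y z → z < y → z < k
Before-descent (inj₁ (_ , y<z)) z<y = contradiction y<z (<⇒≯ z<y)
Before-descent (inj₂ (z<k , _)) _   = z<k

-- The descent puts `y` below `k`, the ascent puts it at or above `k`. This excludes 213 and 312
-- together, both having their least entry in the middle.
Before-no-valley : ∀ {k x y z} → Before k x y → Before k y z → y < x → ¬ y < z
Before-no-valley xy yz y<x y<z = <⇒≱ (Before-descent xy y<x) (Before-ascent yz y<z)

-- The descent from `y` to `z` gives `z < k`, while the ascent from `x` to `y` gives `k ≤ x < z`.
Before-no-132 : ∀ {k x y z} → Before k x y → Before k y z → x < z → ¬ z < y
Before-no-132 xy yz x<z z<y =
  <⇒≱ (Before-descent yz z<y) (≤-trans (Before-ascent xy (<-trans x<z z<y)) (<⇒≤ x<z))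

first-before : ∀ {k z} → k ≢ z → Before k k z
first-before {k} {z} k≢z with <-cmp k z
... | tri< k<z _ _ = inj₁ (≤-refl , k<z)
... | tri≈ _ k≡z _ = contradiction k≡z k≢z
... | tri> _ _ z<k = inj₂ (z<k , z<k)

-- The excluded cases are those in which `k`, `y`, `z` form 132, 213 or 312; in the other three
-- orders `Before` holds. Read from right to left, the excluded patterns are 231, 312 and 213.
avoiding⇒Before : ∀ {k y z} → y ≢ z → k ≢ z →
                  ¬ (k < z × z < y) → ¬ (y < k × k < z) → ¬ (y < z × z < k) → Before k y z
avoiding⇒Before {k} {y} {z} y≢z k≢z ¬132 ¬213 ¬312 with <-cmp y z | <-cmp k z
... | tri≈ _ y≡z _ | _            = contradiction y≡z y≢z
... | _            | tri≈ _ k≡z _ = contradiction k≡z k≢z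
... | tri< y<z _ _ | tri< k<z _ _ = inj₁ (≮⇒≥ (λ y<k → ¬213 (y<k , k<z)) , y<z)
... | tri< y<z _ _ | tri> _ _ z<k = contradiction (y<z , z<k) ¬312
... | tri> _ _ z<y | tri< k<z _ _ = contradiction (k<z , z<y) ¬132
... | tri> _ _ z<y | tri> _ _ z<k = inj₂ (z<k , z<y)

-- Tools for the explicit permutations

range : ℕ → List ℕ
range n = map suc (upTo n)

oneLine-unique : ∀ {n} (π : Permutation n) → Unique (oneLine π)
oneLine-unique {n} π = PermutationSetoid.Unique-resp-↭ (setoid ℕ) (↭⇒↭ₛ (↭-sym (isPermutation π)))
  (Unique.map⁺ suc-injective (Unique.upTo⁺ n))

∈-oneLine⁻ : ∀ {n k} (π : Permutation n) → k ∈ oneLine π → ∃[ m ] m < n × k ≡ suc m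
∈-oneLine⁻ π k∈ with m , m∈ , eq ← ∈-map⁻ suc (∈-resp-↭ (isPermutation π) k∈) = m , ∈-upTo⁻ m∈ , eq

-- The bound is on `f i`, one past the last entry of the rising part, so that it also makes sense
-- when that part is empty.
unimodal-upDown : ∀ (f : ℕ → ℕ) (f< : ∀ t → f t < f (suc t)) i {b σ} → f i ≤ b → Linked _>_ (b ∷ σ) →
                  Unimodal i (length σ) (applyUpTo f i ++ b ∷ σ)
unimodal-upDown f f< zero          fi≤b dec = down dec
unimodal-upDown f f< (suc zero)    fi≤b dec = up (<-≤-trans (f< 0) fi≤b) (down dec)
unimodal-upDown f f< (suc (suc i)) fi≤b dec = up (f< 0) (unimodal-upDown (f ∘ suc) (f< ∘ suc) (suc i) fi≤b dec)

applyUpTo-+ : ∀ {A : Set} (f : ℕ → A) m n → applyUpTo f (m + n) ≡ applyUpTo f m ++ applyUpTo (f ∘ (m +_)) n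
applyUpTo-+ f zero    n = refl
applyUpTo-+ f (suc m) n = cong (f 0 ∷_) (applyUpTo-+ (f ∘ suc) m n)

applyDownFrom-↭ : ∀ {A : Set} (f : ℕ → A) n → applyDownFrom f n ↭ applyUpTo f n
applyDownFrom-↭ f n = ↭-trans (↭-reflexive (sym (reverse-applyUpTo f n))) (↭-reverse (applyUpTo f n))

Linked-applyDownFrom : ∀ k n → Linked _>_ (applyDownFrom (k +_) n)
Linked-applyDownFrom k n = AllPairs⇒Linked
  (AllPairs.applyDownFrom⁺₁ (k +_) n (λ j<i _ → +-monoʳ-< k j<i))

-- Permutations avoiding 132, 213 and 312

module Class₁ where

  ρs : List (∃ Permutation)
  ρs = π132 ∷ π213 ∷ π312 ∷ []

  family : ℕ → ℕ → List ℕ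
  family i m = applyUpTo (suc m +_) (suc i) ++ applyDownFrom suc m

  unimodal : ∀ i m → Unimodal i m (family i m)
  unimodal i m = subst₂ (Unimodal i) (length-applyDownFrom suc m) eq
    (unimodal-upDown (suc m +_) (λ t → +-monoʳ-< (suc m) (n<1+n t)) i {b = suc m + i} ≤-refl dec)
    where
    -- The maximum ends the rising block of `family` but has to start the falling part in
    -- `unimodal-upDown`.
    eq : applyUpTo (suc m +_) i ++ (suc m + i) ∷ applyDownFrom suc m ≡ family i m
    eq = trans (sym (∷ʳ-++ (applyUpTo (suc m +_) i) (suc m + i) (applyDownFrom suc m)))
               (cong (_++ applyDownFrom suc m) (applyUpTo-∷ʳ (suc m +_) i))
    dec : Linked _>_ ((suc m + i) ∷ applyDownFrom suc m)
    dec = AllPairs⇒Linked (All.applyDownFrom⁺₁ suc m (λ j<m → s≤s (≤-trans j<m (m≤m+n m i)))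
      ∷ AllPairs.applyDownFrom⁺₁ suc m (λ j<i _ → s<s j<i))

  family-↭ : ∀ i m → family i m ↭ range (suc (i + m))
  family-↭ i m = begin
    applyUpTo (suc m +_) (suc i) ++ applyDownFrom suc m
      ↭⟨ ++-comm (applyUpTo (suc m +_) (suc i)) (applyDownFrom suc m) ⟩
    applyDownFrom suc m ++ applyUpTo (suc m +_) (suc i)
      ↭⟨ ++⁺ʳ (applyUpTo (suc m +_) (suc i)) (applyDownFrom-↭ suc m) ⟩
    applyUpTo suc m ++ applyUpTo (suc m +_) (suc i)
      ≡⟨ applyUpTo-+ suc m (suc i) ⟨
    applyUpTo suc (m + suc i)
      ≡⟨ cong (applyUpTo suc) (+-comm m (suc i)) ⟩
    applyUpTo suc (suc (i + m))
      ≡⟨ map-upTo suc (suc (i + m)) ⟨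
    range (suc (i + m)) ∎
    where open PermutationReasoning

  family-Before : ∀ i m → AllPairs (Before (suc m)) (family i m)
  family-Before i m = AllPairs.++⁺
    (AllPairs.applyUpTo⁺₁ (suc m +_) (suc i) (λ s<t _ → inj₁ (m≤m+n (suc m) _ , +-monoʳ-< (suc m) s<t)))
    (AllPairs.applyDownFrom⁺₁ suc m (λ j<i i<m → inj₂ (s<s (<-trans j<i i<m) , s<s j<i)))
    (All.applyUpTo⁺₂ (suc m +_) (suc i) λ t →
      All.applyDownFrom⁺₁ suc m λ j<m → inj₂ (s<s j<m , <-≤-trans (s<s j<m) (m≤m+n (suc m) t)))

  Before-avoids : ∀ {n k} (π : Permutation n) → AllPairs (Before k) (oneLine π) →
                  All (λ (_ , ρ) → π Avoids ρ) ρs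
  Before-avoids π Rπ =
    (λ c → let open Occurrence π (proj₂ π132) Rπ c in
      Before-no-132 (related 0F 1F z<s) (related 1F 2F (s<s z<s))
        (ordered 0F 2F (s<s z<s)) (ordered 2F 1F (s<s (s<s z<s)))) ∷
    (λ c → let open Occurrence π (proj₂ π213) Rπ c in
      Before-no-valley (related 0F 1F z<s) (related 1F 2F (s<s z<s))
        (ordered 1F 0F (s<s z<s)) (ordered 1F 2F (s<s z<s))) ∷
    (λ c → let open Occurrence π (proj₂ π312) Rπ c in
      Before-no-valley (related 0F 1F z<s) (related 1F 2F (s<s z<s))
        (ordered 1F 0F (s<s z<s)) (ordered 1F 2F (s<s z<s))) ∷
    []

  -- Only triples starting at the first entry `k` are tested; they already determine the order of
  -- every later pair.
  avoids-Before : ∀ {n k xs} pf → All (λ (_ , ρ) → perm {n} (k ∷ xs) pf Avoids ρ) ρs →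
                  AllPairs (Before k) (k ∷ xs)
  avoids-Before {n} {k} {xs} pf (¬132 ∷ ¬213 ∷ ¬312 ∷ []) =
    All.map first-before k∉ ∷ ⊆⇒AllPairs xs before
    where
    π = perm {n} (k ∷ xs) pf
    k∉ = AllPairs.head (oneLine-unique π)
    before : ∀ {y z} → y ∷ z ∷ [] ⊆ xs → Before k y z
    before τ with (_ ∷ k≢z ∷ []) ∷ (y≢z ∷ []) ∷ _ ← AllPairs-resp-⊆ (refl ∷ τ) (oneLine-unique π) =
      avoiding⇒Before y≢z k≢z
        (λ (k<z , z<y) → ¬132 (⊆⇒contains π (proj₂ π132) refl (refl ∷ τ)
          (inj₁ (<-trans k<z z<y , s<s z<s)) (inj₁ (k<z , s<s z<s)) (inj₂ (z<y , s<s (s<s z<s)))))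
        (λ (y<k , k<z) → ¬213 (⊆⇒contains π (proj₂ π213) refl (refl ∷ τ)
          (inj₂ (y<k , s<s z<s)) (inj₁ (k<z , s<s (s<s z<s))) (inj₁ (<-trans y<k k<z , s<s z<s))))
        (λ (y<z , z<k) → ¬312 (⊆⇒contains π (proj₂ π312) refl (refl ∷ τ)
          (inj₂ (<-trans y<z z<k , s<s z<s)) (inj₂ (z<k , s<s (s<s z<s))) (inj₁ (y<z , s<s z<s))))

  family-avoids : ∀ {n} (π : Permutation n) i m → oneLine π ≡ family i m →
                  All (λ (_ , ρ) → π Avoids ρ) ρs
  family-avoids π i m eq = Before-avoids π (subst (AllPairs (Before (suc m))) (sym eq) (family-Before i m))

  avoids-family : ∀ {n} (π : Permutation (suc n)) → All (λ (_ , ρ) → π Avoids ρ) ρs →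
                  ∃[ i ] i ≤ n × oneLine π ≡ family i (n ∸ i)
  avoids-family (perm [] pf) _ with () ← ↭-length pf
  avoids-family {n} π@(perm (k ∷ xs) pf) avoids with m , s≤s m≤n , refl ← ∈-oneLine⁻ π (here refl) =
    -- The first entry `suc m` has `m` smaller values, which make up the descents, leaving `n ∸ m`
    -- ascents.
    n ∸ m , m∸n≤m n m , subst (λ m' → suc m ∷ xs ≡ family (n ∸ m) m') (sym (m∸[m∸n]≡n m≤n))
      (↭-AllPairs-unique (Before-asym k) (avoids-Before pf avoids) (family-Before (n ∸ m) m)
        (↭-trans pf (↭-sym (subst (λ n' → family (n ∸ m) m ↭ range (suc n'))
          (m∸n+n≡m m≤n) (family-↭ (n ∸ m) m)))))

-- Permutations avoiding 213, 231 and 312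

module Class₂ where

  ρs : List (∃ Permutation)
  ρs = π213 ∷ π231 ∷ π312 ∷ []

  family : ℕ → ℕ → List ℕ
  family i m = applyUpTo suc i ++ applyDownFrom (suc i +_) (suc m)

  unimodal : ∀ i m → Unimodal i m (family i m)
  unimodal i m = subst (λ l → Unimodal i l (family i m)) (length-applyDownFrom (suc i +_) m)
    (unimodal-upDown suc (λ t → n<1+n (suc t)) i (m≤m+n (suc i) m) (Linked-applyDownFrom (suc i) (suc m)))

  family-↭ : ∀ i m → family i m ↭ range (suc (i + m))
  family-↭ i m = begin
    applyUpTo suc i ++ applyDownFrom (suc i +_) (suc m)
      ↭⟨ ++⁺ˡ (applyUpTo suc i) (applyDownFrom-↭ (suc i +_) (suc m)) ⟩
    applyUpTo suc i ++ applyUpTo (suc i +_) (suc m)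
      ≡⟨ applyUpTo-+ suc i (suc m) ⟨
    applyUpTo suc (i + suc m)
      ≡⟨ cong (applyUpTo suc) (+-suc i m) ⟩
    applyUpTo suc (suc (i + m))
      ≡⟨ map-upTo suc (suc (i + m)) ⟨
    range (suc (i + m)) ∎
    where open PermutationReasoning

  family-Before : ∀ i m → AllPairs (flip (Before (suc i))) (family i m)
  family-Before i m = AllPairs.++⁺
    (AllPairs.applyUpTo⁺₁ suc i (λ s<t t<i → inj₂ (s<s (<-trans s<t t<i) , s<s s<t)))
    (AllPairs.applyDownFrom⁺₁ (suc i +_) (suc m) (λ s<t _ → inj₁ (m≤m+n (suc i) _ , +-monoʳ-< (suc i) s<t)))
    (All.applyUpTo⁺₁ suc i λ j<i →
      All.applyDownFrom⁺₂ (suc i +_) (suc m) λ t → inj₂ (s<s j<i , <-≤-trans (s<s j<i) (m≤m+n (suc i) t)))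

  -- Reversal turns 231 into 132 and exchanges 213 with 312, so the same refutations apply with the
  -- outer positions exchanged.
  Before-avoids : ∀ {n k} (π : Permutation n) → AllPairs (flip (Before k)) (oneLine π) →
                  All (λ (_ , ρ) → π Avoids ρ) ρs
  Before-avoids π Rπ =
    (λ c → let open Occurrence π (proj₂ π213) Rπ c in
      Before-no-valley (related 1F 2F (s<s z<s)) (related 0F 1F z<s)
        (ordered 1F 2F (s<s z<s)) (ordered 1F 0F (s<s z<s))) ∷
    (λ c → let open Occurrence π (proj₂ π231) Rπ c in
      Before-no-132 (related 1F 2F (s<s z<s)) (related 0F 1F z<s)
        (ordered 2F 0F (s<s z<s)) (ordered 0F 1F (s<s (s<s z<s)))) ∷
    (λ c → let open Occurrence π (proj₂ π312) Rπ c in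
      Before-no-valley (related 1F 2F (s<s z<s)) (related 0F 1F z<s)
        (ordered 1F 2F (s<s z<s)) (ordered 1F 0F (s<s z<s))) ∷
    []

  avoids-Before : ∀ {n k xs} pf → All (λ (_ , ρ) → perm {n} (xs ++ k ∷ []) pf Avoids ρ) ρs →
                  AllPairs (flip (Before k)) (xs ++ k ∷ [])
  avoids-Before {n} {k} {xs} pf (¬213 ∷ ¬231 ∷ ¬312 ∷ []) =
    AllPairs.++⁺ (⊆⇒AllPairs xs before) ([] ∷ []) (All.tabulate (λ y∈ → last-before y∈ ∷ []))
    where
    π = perm {n} (xs ++ k ∷ []) pf
    last-before : ∀ {y} → y ∈ xs → Before k k y
    last-before y∈ with (y≢k ∷ []) ∷ _ ← AllPairs-resp-⊆ (Sublist.++⁺ (from∈ y∈) ⊆-refl) (oneLine-unique π) =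
      first-before (≢-sym y≢k)
    before : ∀ {z y} → z ∷ y ∷ [] ⊆ xs → Before k y z
    -- The pair is completed by the last entry `k` to a triple, the mirror image of a triple
    -- starting at `k`.
    before {z} {y} τ = helper (Sublist.++⁺ τ ⊆-refl)
      where
      helper : z ∷ y ∷ k ∷ [] ⊆ xs ++ k ∷ [] → Before k y z
      helper τ' with (z≢y ∷ z≢k ∷ []) ∷ _ ← AllPairs-resp-⊆ τ' (oneLine-unique π) =
        avoiding⇒Before (≢-sym z≢y) (≢-sym z≢k)
          (λ (k<z , z<y) → ¬231 (⊆⇒contains π (proj₂ π231) refl τ'
            (inj₁ (z<y , s<s (s<s z<s))) (inj₂ (k<z , s<s z<s)) (inj₂ (<-trans k<z z<y , s<s z<s))))
          (λ (y<k , k<z) → ¬312 (⊆⇒contains π (proj₂ π312) refl τ'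
            (inj₂ (<-trans y<k k<z , s<s z<s)) (inj₂ (k<z , s<s (s<s z<s))) (inj₁ (y<k , s<s z<s))))
          (λ (y<z , z<k) → ¬213 (⊆⇒contains π (proj₂ π213) refl τ'
            (inj₂ (y<z , s<s z<s)) (inj₁ (z<k , s<s (s<s z<s))) (inj₁ (<-trans y<z z<k , s<s z<s))))

  family-avoids : ∀ {n} (π : Permutation n) i m → oneLine π ≡ family i m →
                  All (λ (_ , ρ) → π Avoids ρ) ρs
  family-avoids π i m eq = Before-avoids π (subst (AllPairs (flip (Before (suc i)))) (sym eq) (family-Before i m))

  avoids-family : ∀ {n} (π : Permutation (suc n)) → All (λ (_ , ρ) → π Avoids ρ) ρs →
                  ∃[ i ] i ≤ n × oneLine π ≡ family i (n ∸ i)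
  avoids-family (perm l pf) avoids with initLast l
  avoids-family (perm .[] pf) _ | [] with () ← ↭-length pf
  avoids-family {n} (perm .(xs ++ k ∷ []) pf) avoids | xs ∷ʳ′ k
    -- The last entry is `suc i`, and the `i` smaller values form the rising part, so it gives the
    -- number of ascents directly.
    with i , s≤s i≤n , refl ← ∈-oneLine⁻ (perm _ pf) (∈-++⁺ʳ xs (here refl)) =
    i , i≤n , ↭-AllPairs-unique (flip (Before-asym k)) (avoids-Before pf avoids) (family-Before i (n ∸ i))
      (↭-trans pf (↭-sym (subst (λ n' → family i (n ∸ i) ↭ range (suc n'))
        (m+[n∸m]≡n i≤n) (family-↭ i (n ∸ i)))))

theorem13 : ∀ (n : ℕ) → 1 ≤ n →
    (pf[ n , π132 ∷ π213 ∷ π312 ∷ [] ]≡ (catalan (suc n) ∸ catalan n))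
    × (pf[ n , π213 ∷ π231 ∷ π312 ∷ [] ]≡ (catalan (suc n) ∸ catalan n))
theorem13 (suc n) _ = C₁.count n , C₂.count n
  where
  module C₁ = Counting Class₁.ρs Class₁.family Class₁.unimodal Class₁.family-↭
                       Class₁.family-avoids Class₁.avoids-family
  module C₂ = Counting Class₂.ρs Class₂.family Class₂.unimodal Class₂.family-↭
                       Class₂.family-avoids Class₂.avoids-family
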